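{- Let $A$ be an ordered graph and let $G$ be a member of the family $P\,\mathbb{y}\,A\,\mathbb{x}\,Q$ or of the family $P\,\mathbb{y}\,A\,\mathbb{x}\,R$, where $P$ is the ordered matching on $[10]$ with edges $\{1,3\},\{2,5\},\{4,9\},\{6,7\},\{8,10\}$, $Q$ is the ordered matching on $[10]$ with edges $\{1,3\},\{2,7\},\{4,5\},\{6,9\},\{8,10\}$, and $R$ is the ordered matching on $[8]$ with edges $\{1,3\},\{2,5\},\{4,7\},\{6,8\}$. If $G$ is not separable and $G$ has no vertex of degree zero and no vertex of degree two, then $sat_{<}(n,G)=O(1)$.
   Context: An ordered graph is a finite simple graph whose vertex set is linearly ordered (identified with $[m]$ with the natural order). An ordered graph $H$ contains an ordered graph $G$ if there is an injective order-preserving map $\varphi:V(G)\to V(H)$ with $\varphi(u)\varphi(v)\in E(H)$ for all $uv\in E(G)$; otherwise $H$ avoids $G$. $H$ saturates $G$ if $H$ avoids $G$ but adding any non-edge to $H$ yields a graph containing $G$. $sat_{<}(n,G)$ is the minimum number of edges of an ordered graph on $n$ vertices saturating $G$. Edges are written $uv$ with $u<v$. $G$ is separable if its edge set can be partitioned into two non-empty parts $E_1,E_2$ such that $u_1<v_1<u_2<v_2$ for all $u_1v_1\in E_1$, $u_2v_2\in E_2$. For ordered graphs $A,G_1,G_2$ on $n_0,n_1,n_2$ vertices, $G_1\,\mathbb{y}\,A\,\mathbb{x}\,G_2$ denotes the family of ordered graphs on vertex set $[n_1+n_0+n_2-2]$ obtained by choosing vertices $i,j$ with $n_1\le i,j\le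 n_1+n_0-1$ and taking the union of: a copy of $G_1$ placed (order-preservingly) on $\{1,\dots,n_1-1\}\cup\{i\}$, a copy of $A$ placed on $\{n_1,\dots,n_1+n_0-1\}$, and a copy of $G_2$ placed on $\{j\}\cup\{n_1+n_0,\dots,n_1+n_0+n_2-2\}$. (In the paper's notation $P=\Gamma_{\{0,0,1,0\}}$, $Q=\Gamma_{\{0,1,0,0\}}$, $R=\Gamma_4$.) -}

module Defs where

open import Data.Nat using (ℕ; zero; suc; _+_; _≤_; _<ᵇ_; _≡ᵇ_)
open import Data.Fin using (Fin; toℕ) renaming (_<_ to _<ᶠ_)
open import Data.Bool using (Bool; true; false; _∧_; _∨_; if_then_else_)
open import Data.List using (List; []; _∷_; map; allFin)
open import Data.Nat.ListAction using (sum)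
open import Data.Bool.ListAction using (any)
open import Data.Product using (Σ; ∃; _×_; _,_)
open import Relation.Binary.PropositionalEquality using (_≡_)
open import Relation.Nullary using (¬_)

-- An ordered graph on vertex set Fin n (= [n] with natural order).
-- uv (u < v) is an edge iff adj u v ≡ true; entries with u ≥ v are ignored.
OGraph : ℕ → Set
OGraph n = Fin n → Fin n → Bool

Edge : ∀ {n} → OGraph n → Fin n → Fin n → Set
Edge H u v = (u <ᶠ v) × (H u v ≡ true)

edgeᵇ : ∀ {n} → OGraph n → Fin n → Fin n → Bool
edgeᵇ H u v = (toℕ u <ᵇ toℕ v) ∧ H u v

edgeCount : ∀ {n} → OGraph n → ℕ
edgeCount {n} H =
  sum (map (λ u → sum (map (λ v → if edgeᵇ H u v then 1 else 0) (allFin n))) (allFin n))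

degree : ∀ {n} → OGraph n → Fin n → ℕ
degree {n} H v = sum (map (λ u → if edgeᵇ H u v ∨ edgeᵇ H v u then 1 else 0) (allFin n))

Contains : ∀ {n m} → OGraph n → OGraph m → Set
Contains {n} {m} H G =
  Σ (Fin m → Fin n) λ φ →
    (∀ u v → u <ᶠ v → φ u <ᶠ φ v) ×
    (∀ u v → Edge G u v → Edge H (φ u) (φ v))

addEdge : ∀ {n} → OGraph n → Fin n → Fin n → OGraph n
addEdge H u v x y = H x y ∨ ((toℕ x ≡ᵇ toℕ u) ∧ (toℕ y ≡ᵇ toℕ v))

Saturates : ∀ {n m} → OGraph n → OGraph m → Set
Saturates H G =
  (¬ Contains H G) ×
  (∀ u v → u <ᶠ v → H u v ≡ false → Contains (addEdge H u v) G)

-- sat_<(n,G) = O(1): there are constants C, N such that for all n ≥ N,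
-- sat_<(n,G) ≤ C, i.e. some n-vertex ordered graph saturating G has ≤ C edges.
SatBounded : ∀ {m} → OGraph m → Set
SatBounded G =
  ∃ λ (C : ℕ) → ∃ λ (N : ℕ) → ∀ (n : ℕ) → N ≤ n →
    Σ (OGraph n) λ H → Saturates H G × (edgeCount H ≤ C)

Separable : ∀ {m} → OGraph m → Set
Separable {m} G =
  Σ (Fin m → Fin m → Bool) λ c →
    (∃ λ u → ∃ λ v → Edge G u v × (c u v ≡ true)) ×
    (∃ λ u → ∃ λ v → Edge G u v × (c u v ≡ false)) ×
    (∀ u₁ v₁ u₂ v₂ → Edge G u₁ v₁ → c u₁ v₁ ≡ true →
       Edge G u₂ v₂ → c u₂ v₂ ≡ false →
       (u₁ <ᶠ v₁) × (v₁ <ᶠ u₂) × (u₂ <ᶠ v₂))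

-- ordered graph from a list of 1-based edges {a,b}, a < b
fromEdges : (n : ℕ) → List (ℕ × ℕ) → OGraph n
fromEdges n es x y =
  any (λ { (a , b) → (suc (toℕ x) ≡ᵇ a) ∧ (suc (toℕ y) ≡ᵇ b) }) es

P : OGraph 10
P = fromEdges 10 ((1 , 3) ∷ (2 , 5) ∷ (4 , 9) ∷ (6 , 7) ∷ (8 , 10) ∷ [])

Q : OGraph 10
Q = fromEdges 10 ((1 , 3) ∷ (2 , 7) ∷ (4 , 5) ∷ (6 , 9) ∷ (8 , 10) ∷ [])

R : OGraph 8
R = fromEdges 8 ((1 , 3) ∷ (2 , 5) ∷ (4 , 7) ∷ (6 , 8) ∷ [])

-- The member of G₁ ⋎ A ⋏ G₂ determined by i, j (0-based vertices of A).
-- With n₁ = suc a, n₂ = suc b, the vertex set is [n₁ + n₀ + n₂ - 2] = Fin (a + n₀ + b),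
-- 0-based: G₁ on {0..a-1} ∪ {a+i}, A on {a..a+n₀-1}, G₂ on {a+j} ∪ {a+n₀..a+n₀+b-1}.
module _ {a n₀ b : ℕ} (G₁ : OGraph (suc a)) (A : OGraph n₀) (G₂ : OGraph (suc b))
         (i j : Fin n₀) where

  private
    e₁ : Fin (suc a) → ℕ
    e₁ x = if toℕ x <ᵇ a then toℕ x else a + toℕ i

    eA : Fin n₀ → ℕ
    eA x = a + toℕ x

    e₂ : Fin (suc b) → ℕ
    e₂ Fin.zero = a + toℕ j
    e₂ (Fin.suc y) = a + n₀ + toℕ y

    image : ∀ {k} → OGraph k → (Fin k → ℕ) → ℕ → ℕ → Bool
    image {k} K e u v =
      any (λ x → any (λ y → edgeᵇ K x y ∧ (e x ≡ᵇ u) ∧ (e y ≡ᵇ v)) (allFin k)) (allFin k)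

  glue : OGraph (a + n₀ + b)
  glue u v = image G₁ e₁ (toℕ u) (toℕ v) ∨ image A eA (toℕ u) (toℕ v)
             ∨ image G₂ e₂ (toℕ u) (toℕ v)

Claim : ∀ {m} → OGraph m → Set
Claim {m} G =
  ¬ Separable G →
  (∀ v → ¬ (degree G v ≡ 0)) →
  (∀ v → ¬ (degree G v ≡ 2)) →
  SatBounded G

{-# OPTIONS --safe #-}
module Submission where

-- Let G have vertices 0, …, 8 + k. The only edges leaving {0, …, 8} are 02, 14, 38, 56 and one edge at 7; the
-- only edges ending after k + 3 are {lo, k + 5} with lo < k + 4, {k + 4, k + 7} and {k + 6, k + 8}.
-- We build a graph with boundedly many edges that avoids G and has an interval I of arbitrarily many isolated
-- vertices, between two vertices p and q, such that any new edge touching I creates a copy of G: the new edge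
-- plays the role of 02 if it ends in I and starts before p, of {k + 6, k + 8} if it starts in I and ends after q,
-- and of 56 otherwise. Completing this graph greedily to one that saturates G then never adds an edge touching I.
--
-- To see that G is avoided, consider the image of the edge 02 in a copy of G, in terms of the blocks used in Adj.
-- The edges 14, 38, 56 and the edge at 7 exclude most cases immediately. If 02 starts at p, at q or in block 10, the
-- copy lies before block 11 because G is not separable, and there it runs out of vertices. If 02 starts in block 4,
-- non-separability makes an edge cross each of three cuts, and since p and q have degree two while G has no vertex
-- of degree two, p and q are used only as right endpoints, so that nothing is left to cross the third cut.

open import Defs
open import Data.Nat hiding (_≟_; _<?_; _≤?_)
open import Data.Nat.Properties
open import Data.Nat.ListAction using (sum)
open import Data.Fin using (Fin; zero; suc; toℕ; fromℕ<; _↑ˡ_; _↑ʳ_) renaming (_<_ to _<ᶠ_)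
import Data.Fin.Properties as Fin
open import Data.Fin.Patterns
open import Data.Product using (Σ; ∃; ∃₂; _×_; _,_; proj₁; proj₂)
open import Data.Product.Properties using (≡-dec)
open import Data.Sum as Sum using (_⊎_; inj₁; inj₂; [_,_])
open import Data.Unit using (⊤; tt)
open import Data.Empty using (⊥; ⊥-elim)
open import Data.Bool using (Bool; true; false; _∧_; _∨_; if_then_else_) renaming (_≟_ to _≟ᵇ_)
open import Data.Bool.ListAction using (any)
open import Data.Bool.Properties using (T-≡; ∨-zeroʳ; ¬-not)
open import Data.List using (List; []; _∷_; map; foldr; allFin; tabulate; cartesianProduct)
open import Data.List.Membership.Propositional using (_∈_)
open import Data.List.Membership.Propositional.Properties using (∈-allFin; ∈-tabulate⁻; ∈-cartesianProduct⁺)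
open import Data.List.Properties using (map-tabulate)
open import Data.List.Relation.Unary.All as All using (All; []; _∷_)
open import Data.List.Relation.Unary.Any using (here; there)
open import Data.Vec as Vec using (Vec; []; _∷_)
open import Data.Vec.Properties using (lookup∘tabulate)
open import Function using (_∘_; id; case_of_; Equivalence)
open import Relation.Binary.Definitions using (tri<; tri≈; tri>)
open import Relation.Binary.PropositionalEquality hiding ([_])
open import Relation.Nullary
open import Relation.Nullary.Decidable using (map′; dec-true; dec-false)

-- Vertices as pairs of a block and an index, ordered lexicographically.

Vertex : Set
Vertex = ℕ × ℕ

-- Defined by recursion on the blocks, so that comparing literal blocks computes to the unit type,
-- the empty type or the comparison `p` of the indices. Impossible cases of the later analyses then
-- vanish by pattern matching.
lex : ℕ → ℕ → Set → Set
lex zero    zero    p = p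
lex zero    (suc _) p = ⊤
lex (suc _) zero    p = ⊥
lex (suc a) (suc b) p = lex a b p

infix 4 _≺_
_≺_ : Vertex → Vertex → Set
(a , i) ≺ (b , j) = lex a b (i < j)

lex-dec : ∀ a b {p} → Dec p → Dec (lex a b p)
lex-dec zero    zero    d = d
lex-dec zero    (suc _) d = yes tt
lex-dec (suc _) zero    d = no λ ()
lex-dec (suc a) (suc b) d = lex-dec a b d

_≺?_ : ∀ a b → Dec (a ≺ b)
(a , i) ≺? (b , j) = lex-dec a b (i <? j)

lex-trans : ∀ a b c {p q r : Set} → (p → q → r) → lex a b p → lex b c q → lex a c r
lex-trans zero    zero    zero    f x y = f x y
lex-trans zero    zero    (suc c) f x y = tt
lex-trans zero    (suc b) (suc c) f x y = tt
lex-trans (suc a) (suc b) (suc c) f x y = lex-trans a b c f x y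

≺-trans : ∀ a b c → a ≺ b → b ≺ c → a ≺ c
≺-trans (a , _) (b , _) (c , _) = lex-trans a b c <-trans

lex-irrefl : ∀ a {p} → ¬ p → ¬ lex a a p
lex-irrefl zero    f = f
lex-irrefl (suc a) f = lex-irrefl a f

≺-irrefl : ∀ {a} → ¬ a ≺ a
≺-irrefl {a , i} = lex-irrefl a (<-irrefl refl)

≮≺-trans : ∀ {t a b} → ¬ a ≺ t → a ≺ b → t ≺ b
≮≺-trans {t , i} {a , j} {b , l} = go t a b
  where
  go : ∀ t a b → ¬ lex a t (j < i) → lex a b (j < l) → lex t b (i < l)
  go zero    zero    zero    n x = ≤-<-trans (≮⇒≥ n) x
  go zero    zero    (suc b) n x = tt
  go zero    (suc a) (suc b) n x = tt
  go (suc t) zero    b       n x = ⊥-elim (n tt)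
  go (suc t) (suc a) (suc b) n x = go t a b n x

≺-step↑ : ∀ {b d a c} → (b , d) ≺ a → a ≺ c → (b , suc d) ≺ c
≺-step↑ {b} {d} {a , i} {c , j} = lex-trans b a c (λ x y → ≤-<-trans x y)

≺-step↓ : ∀ {a c b d} → a ≺ c → c ≺ (b , suc d) → a ≺ (b , d)
≺-step↓ {a , i} {c , j} {b} = lex-trans a c b (λ x y → <-≤-trans x (≤-pred y))

-- Numbering the vertices of consecutive blocks.

Valid : List ℕ → Vertex → Set
Valid []       _           = ⊥
Valid (s ∷ ss) (zero  , i) = i < s
Valid (s ∷ ss) (suc b , i) = Valid ss (b , i)

shift : Vertex → Vertex
shift (b , i) = suc b , i

-- Numbers beyond the listed blocks fall into one more, unbounded block; this lets `decode-mono`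
-- hold without a bound.
decode : List ℕ → ℕ → Vertex
decode []       x = 0 , x
decode (s ∷ ss) x with x <? s
... | yes _ = 0 , x
... | no  _ = shift (decode ss (x ∸ s))

decode-valid : ∀ ss {x} → x < sum ss → Valid ss (decode ss x)
decode-valid (s ∷ ss) {x} h with x <? s
... | yes p = p
... | no  p = decode-valid ss (+-cancelˡ-< s _ _ (subst (_< s + sum ss) (sym (m+[n∸m]≡n (≮⇒≥ p))) h))

decode-mono : ∀ ss {x y} → x < y → decode ss x ≺ decode ss y
decode-mono []       h = h
decode-mono (s ∷ ss) {x} {y} h with x <? s | y <? s
... | yes p | yes q = h
... | yes p | no  q = tt
... | no  p | yes q = ⊥-elim (p (<-trans h q))
... | no  p | no  q = decode-mono ss (∸-monoˡ-< h (≮⇒≥ p))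

encode : List ℕ → Vertex → ℕ
encode []       (_     , i) = i
encode (s ∷ ss) (zero  , i) = i
encode (s ∷ ss) (suc b , i) = s + encode ss (b , i)

encode-< : ∀ ss v → Valid ss v → encode ss v < sum ss
encode-< (s ∷ ss) (zero  , i) h = <-≤-trans h (m≤m+n s _)
encode-< (s ∷ ss) (suc b , i) h = +-monoʳ-< s (encode-< ss (b , i) h)

decode∘encode : ∀ ss v → Valid ss v → decode ss (encode ss v) ≡ v
decode∘encode (s ∷ ss) (zero  , i) h with i <? s
... | yes _ = refl
... | no  n = ⊥-elim (n h)
decode∘encode (s ∷ ss) (suc b , i) h with (s + encode ss (b , i)) <? s
... | yes q = ⊥-elim (<⇒≱ q (m≤m+n s _))
... | no  _ = cong shift (trans (cong (decode ss) (m+n∸m≡n s _)) (decode∘encode ss (b , i) h))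

-- The edges of the unsaturated graph.

module _ (k lo : ℕ) where

  -- Vertices are pairs of a block and an index; block 7 is I, p = (6 , 0) and q = (8 , 0). A new edge from x to y
  -- becomes part of a copy of G with vertices (in order) x p y q and block 10 in the role of 02, blocks 0 1 2 3 5,
  -- x y, 9 and block 11 in the role of 56, and block 4, p x q y in the role of the last edge.
  -- The names x13, x25, x49 refer to the edges of P, x8i to the glued edge at 8 (both 1-based).
  data Adj : Vertex → Vertex → Set where
    x13 : Adj (0 , 0) (2 , 0)
    x25 : Adj (1 , 0) (5 , 0)
    x49 : Adj (3 , 0) (11 , 8)
    zl  : ∀ {u v} → u < k + 4 → v < k + 4 → Adj (4 , u) (4 , v)
    lop : Adj (4 , lo) (6 , 0)
    bq  : Adj (4 , k + 4) (8 , 0)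
    p5y : Adj (6 , 0) (10 , 4)
    q9y : Adj (8 , 0) (10 , 8)
    yr  : ∀ {u v} → 5 ≤ u → 5 ≤ v → Adj (10 , u) (10 , v)
    x8i : ∀ {i} → 9 ≤ i → Adj (9 , 0) (11 , i)
    xr  : ∀ {u v} → 9 ≤ u → 9 ≤ v → Adj (11 , u) (11 , v)

  -- A sum of equations is decidable piece by piece. The parameters of the edge families are read
  -- off the indices `i` and `j`, so nothing has to be searched.
  AdjCases : Vertex → Vertex → Set
  AdjCases a@(_ , i) b@(_ , j) =
      (a ≡ (0 , 0) × b ≡ (2 , 0)) ⊎
      (a ≡ (1 , 0) × b ≡ (5 , 0)) ⊎
      (a ≡ (3 , 0) × b ≡ (11 , 8)) ⊎
      ((i < k + 4 × j < k + 4) × a ≡ (4 , i) × b ≡ (4 , j)) ⊎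
      (a ≡ (4 , lo) × b ≡ (6 , 0)) ⊎
      (a ≡ (4 , k + 4) × b ≡ (8 , 0)) ⊎
      (a ≡ (6 , 0) × b ≡ (10 , 4)) ⊎
      (a ≡ (8 , 0) × b ≡ (10 , 8)) ⊎
      ((5 ≤ i × 5 ≤ j) × a ≡ (10 , i) × b ≡ (10 , j)) ⊎
      ((9 ≤ j) × a ≡ (9 , 0) × b ≡ (11 , j)) ⊎
      ((9 ≤ i × 9 ≤ j) × a ≡ (11 , i) × b ≡ (11 , j))

  AdjCases? : ∀ a b → Dec (AdjCases a b)
  AdjCases? a@(_ , i) b@(_ , j) =
      (a ≟ᵛ (0 , 0) ×-dec b ≟ᵛ (2 , 0)) ⊎-dec
      (a ≟ᵛ (1 , 0) ×-dec b ≟ᵛ (5 , 0)) ⊎-dec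
      (a ≟ᵛ (3 , 0) ×-dec b ≟ᵛ (11 , 8)) ⊎-dec
      ((i <? k + 4 ×-dec j <? k + 4) ×-dec a ≟ᵛ (4 , i) ×-dec b ≟ᵛ (4 , j)) ⊎-dec
      (a ≟ᵛ (4 , lo) ×-dec b ≟ᵛ (6 , 0)) ⊎-dec
      (a ≟ᵛ (4 , k + 4) ×-dec b ≟ᵛ (8 , 0)) ⊎-dec
      (a ≟ᵛ (6 , 0) ×-dec b ≟ᵛ (10 , 4)) ⊎-dec
      (a ≟ᵛ (8 , 0) ×-dec b ≟ᵛ (10 , 8)) ⊎-dec
      ((5 ≤? i ×-dec 5 ≤? j) ×-dec a ≟ᵛ (10 , i) ×-dec b ≟ᵛ (10 , j)) ⊎-dec
      ((9 ≤? j) ×-dec a ≟ᵛ (9 , 0) ×-dec b ≟ᵛ (11 , j)) ⊎-dec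
      ((9 ≤? i ×-dec 9 ≤? j) ×-dec a ≟ᵛ (11 , i) ×-dec b ≟ᵛ (11 , j))
    where
    _≟ᵛ_ : (a b : Vertex) → Dec (a ≡ b)
    _≟ᵛ_ = ≡-dec _≟_ _≟_

  -- Later steps use only that the answer is correct, so the decision procedure stays folded.
  abstract

    Adj? : ∀ a b → Dec (Adj a b)
    Adj? a b = map′ to from (AdjCases? a b)
      where
      to : AdjCases a b → Adj a b
      to (inj₁ (refl , refl)) = x13
      to (inj₂ (inj₁ (refl , refl))) = x25
      to (inj₂ (inj₂ (inj₁ (refl , refl)))) = x49
      to (inj₂ (inj₂ (inj₂ (inj₁ ((p , q) , refl , refl))))) = zl p q
      to (inj₂ (inj₂ (inj₂ (inj₂ (inj₁ (refl , refl)))))) = lop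
      to (inj₂ (inj₂ (inj₂ (inj₂ (inj₂ (inj₁ (refl , refl))))))) = bq
      to (inj₂ (inj₂ (inj₂ (inj₂ (inj₂ (inj₂ (inj₁ (refl , refl)))))))) = p5y
      to (inj₂ (inj₂ (inj₂ (inj₂ (inj₂ (inj₂ (inj₂ (inj₁ (refl , refl))))))))) = q9y
      to (inj₂ (inj₂ (inj₂ (inj₂ (inj₂ (inj₂ (inj₂ (inj₂ (inj₁ ((p , q) , refl , refl)))))))))) = yr p q
      to (inj₂ (inj₂ (inj₂ (inj₂ (inj₂ (inj₂ (inj₂ (inj₂ (inj₂ (inj₁ (p , refl , refl))))))))))) = x8i p
      to (inj₂ (inj₂ (inj₂ (inj₂ (inj₂ (inj₂ (inj₂ (inj₂ (inj₂ (inj₂ ((p , q) , refl , refl))))))))))) = xr p q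
      from : Adj a b → AdjCases a b
      from x13 = inj₁ (refl , refl)
      from x25 = inj₂ (inj₁ (refl , refl))
      from x49 = inj₂ (inj₂ (inj₁ (refl , refl)))
      from (zl p q) = inj₂ (inj₂ (inj₂ (inj₁ ((p , q) , refl , refl))))
      from lop = inj₂ (inj₂ (inj₂ (inj₂ (inj₁ (refl , refl)))))
      from bq = inj₂ (inj₂ (inj₂ (inj₂ (inj₂ (inj₁ (refl , refl))))))
      from p5y = inj₂ (inj₂ (inj₂ (inj₂ (inj₂ (inj₂ (inj₁ (refl , refl)))))))
      from q9y = inj₂ (inj₂ (inj₂ (inj₂ (inj₂ (inj₂ (inj₂ (inj₁ (refl , refl))))))))
      from (yr p q) = inj₂ (inj₂ (inj₂ (inj₂ (inj₂ (inj₂ (inj₂ (inj₂ (inj₁ ((p , q) , refl , refl)))))))))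
      from (x8i p) = inj₂ (inj₂ (inj₂ (inj₂ (inj₂ (inj₂ (inj₂ (inj₂ (inj₂ (inj₁ (p , refl , refl))))))))))
      from (xr p q) = inj₂ (inj₂ (inj₂ (inj₂ (inj₂ (inj₂ (inj₂ (inj₂ (inj₂ (inj₂ ((p , q) , refl , refl))))))))))

  -- Possible images of the edge 02.

  data Start (a₀ a₁ a₂ a₄ : Vertex) : Set where
    lower : ∀ {i} → i < k + 4 → a₀ ≡ (4 , i) → Start a₀ a₁ a₂ a₄
    upper : (5 , 0) ≺ a₀ → a₀ ≺ (11 , 0) → a₀ ≢ (9 , 0) → a₁ ≢ (9 , 0) → (9 , 0) ≺ a₂ →
           (10 , 0) ≺ a₀ ⊎ (10 , 2) ≺ a₂ ⊎ (10 , 4) ≺ a₄ →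
           Start a₀ a₁ a₂ a₄

  -- Every edge starting beyond block 5 ends in block 10 or 11. The room between blocks 5 and 9 is
  -- kept free for a new edge in the role of 56.
  gap : ∀ {a b} → (5 , 0) ≺ a → b ≺ (9 , 0) → ¬ Adj a b
  gap () h x13
  gap () h x25
  gap () h x49
  gap () h (zl _ _)
  gap () h lop
  gap () h bq
  gap h () p5y
  gap h () q9y
  gap h () (yr _ _)
  gap h () (x8i _)
  gap h () (xr _ _)

  gap′ : ∀ {a b} → (5 , 0) ≺ a → a ≺ (6 , 0) → ¬ Adj a b
  gap′ h h′ p5y = ≺-irrefl {6 , 0} h′

  across5 : ∀ {a b} → (1 , 0) ≺ a → a ≺ (5 , 0) → (5 , 0) ≺ b → Adj a b →
            b ≡ (11 , 8) ⊎ b ≡ (6 , 0) ⊎ b ≡ (8 , 0)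
  across5 p q r x49 = inj₁ refl
  across5 p q r lop = inj₂ (inj₁ refl)
  across5 p q r bq = inj₂ (inj₂ refl)

  source-1 : ∀ {a b} → (0 , 0) ≺ a → a ≺ (2 , 0) → Adj a b → b ≡ (5 , 0)
  source-1 p q x25 = refl

  into-11 : ∀ {a b} → (5 , 0) ≺ a → a ≺ (11 , 8) → (11 , 8) ≺ b → Adj a b → a ≡ (9 , 0)
  into-11 p q r (x8i _) = refl
  into-11 p q r (xr h _) = ⊥-elim (<⇒≱ q (≤-trans (n≤1+n 8) h))

  module _ (lo< : lo < k + 4) where

    from-p : ∀ {a b} → (4 , k + 4) ≺ a → a ≺ (8 , 0) → Adj a b → b ≡ (10 , 4)
    from-p p q (zl h _) = ⊥-elim (<-asym h p)
    from-p p q lop      = ⊥-elim (<-asym lo< p)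
    from-p p q bq       = ⊥-elim (<-irrefl refl p)
    from-p p q p5y      = refl

    from-8 : ∀ {a b} → (8 , 0) ≺ a → a ≺ (10 , 5) → Adj a b → (11 , 8) ≺ b
    from-8 p q (yr h _) = ⊥-elim (<⇒≱ q h)
    from-8 p q (x8i h)  = h

    not-9 : ∀ {b} → ¬ (11 , 4) ≺ b → ¬ Adj (9 , 0) b
    not-9 c (x8i h) = c (≤-trans (m≤m+n 5 4) h)

    from-6 : ∀ {a b} → (6 , 0) ≺ a → a ≺ (10 , 4) → ¬ (11 , 4) ≺ b → Adj a b → (10 , 4) ≺ b
    from-6 p q c q9y      = m≤m+n 5 3
    from-6 p q c (yr h _) = ⊥-elim (<⇒≱ q (≤-trans (n≤1+n 4) h))
    from-6 p q c (x8i h)  = ⊥-elim (not-9 c (x8i h))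

    -- Each numbered point is the image of that vertex, and `aᵢ` that of the right end of the edge
    -- at 7. The bounds on `a₂`, `a₄` and `a₈` rule out edges reaching too far into block 11. In
    -- `upper`, vertex 0, 2 or 4 is beyond the place of its own number in block 10, which
    -- `not-upper` refutes.
    start : ∀ {a₀ a₁ a₂ a₃ a₄ a₅ a₆ a₇ a₈ aᵢ} →
      a₀ ≺ a₁ → a₁ ≺ a₂ → a₂ ≺ a₃ → a₃ ≺ a₄ → a₂ ≺ a₄ → a₄ ≺ a₅ → a₄ ≺ a₇ → a₄ ≺ a₈ → a₅ ≺ a₈ →
      a₆ ≺ a₇ → a₆ ≺ a₈ → a₇ ≺ a₈ → a₈ ≺ aᵢ → ¬ (11 , 2) ≺ a₂ → ¬ (11 , 4) ≺ a₄ → ¬ (11 , 8) ≺ a₈ →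
      Adj a₀ a₂ → Adj a₁ a₄ → Adj a₃ a₈ → Adj a₅ a₆ → Adj a₇ aᵢ → Start a₀ a₁ a₂ a₄
    start {a₃ = a₃} {a₅ = a₅} {a₆ = a₆}
      o01 o12 o23 o34 o24 o45 o47 o48 o58 o67 o68 o78 o8i c2 c4 c8 x13 e14 e38 e56 e7i
      -- Now 14 must join blocks 1 and 5. Wherever 38 ends, 56 is confined between blocks 5 and 9,
      -- where `gap` applies: if 38 ends at (11 , 8), the edge at 7 has to start at (9 , 0).
      with refl ← source-1 o01 o12 e14
      with across5 (≺-trans (1 , 0) (2 , 0) a₃ tt o23) o34 o48 e38
    ... | inj₁ refl        = ⊥-elim (gap o45 (subst (a₆ ≺_) (into-11 o47 o78 o8i e7i) o67) e56)
    ... | inj₂ (inj₁ refl) = ⊥-elim (gap o45 (≺-trans a₆ (6 , 0) (9 , 0) o68 tt) e56)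
    ... | inj₂ (inj₂ refl) = ⊥-elim (gap o45 (≺-trans a₆ (8 , 0) (9 , 0) o68 tt) e56)
    start {a₃ = a₃} {a₅ = a₅} {a₆ = a₆}
      o01 o12 o23 o34 o24 o45 o47 o48 o58 o67 o68 o78 o8i c2 c4 c8 x25 e14 e38 e56 e7i
      -- If 14 ends at p, there is no place for the left end of 38 between block 5 and p. If it ends
      -- at q, then 38 runs from p to (10 , 4), and edges starting between q and there end beyond
      -- (11 , 8), too far for 56.
      with across5 o01 o12 o24 e14
    ... | inj₁ refl        = ⊥-elim (c4 (m≤m+n 5 3))
    ... | inj₂ (inj₁ refl) = ⊥-elim (gap′ o23 o34 e38)
    ... | inj₂ (inj₂ refl)
        with refl ← from-p (≺-trans (4 , k + 4) (5 , 0) a₃ tt o23) o34 e38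
        = ⊥-elim (≺-trans (11 , 8) a₆ (10 , 4) (from-8 o45 (≺-trans a₅ (10 , 4) (10 , 5) o58 ≤-refl) e56) o68)
    start o01 o12 o23 o34 o24 o45 o47 o48 o58 o67 o68 o78 o8i c2 c4 c8 x49 e14 e38 e56 e7i =
      ⊥-elim (c2 (m≤m+n 3 5))
    start o01 o12 o23 o34 o24 o45 o47 o48 o58 o67 o68 o78 o8i c2 c4 c8 (zl h _) e14 e38 e56 e7i =
      lower h refl
    start o01 o12 o23 o34 o24 o45 o47 o48 o58 o67 o68 o78 o8i c2 c4 c8 lop e14 e38 e56 e7i =
      lower lo< refl
    start {a₃ = a₃} {a₅ = a₅} {a₆ = a₆}
      o01 o12 o23 o34 o24 o45 o47 o48 o58 o67 o68 o78 o8i c2 c4 c8 bq e14 e38 e56 e7i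
      -- With 14 forced to run from p to (10 , 4), the edge 38 starts between q and that place and
      -- so ends beyond (11 , 8).
      with refl ← from-p o01 o12 e14 = ⊥-elim (c8 (from-8 o23 (≺-trans a₃ (10 , 4) (10 , 5) o34 ≤-refl) e38))
    start o01 o12 o23 o34 o24 o45 o47 o48 o58 o67 o68 o78 o8i c2 c4 c8 p5y e14 e38 e56 e7i =
      upper tt tt (λ ()) (λ {refl → not-9 c4 e14}) tt
        (inj₂ (inj₂ (from-6 o01 o12 c4 e14)))
    start o01 o12 o23 o34 o24 o45 o47 o48 o58 o67 o68 o78 o8i c2 c4 c8 q9y e14 e38 e56 e7i =
      upper tt tt (λ ()) (λ {refl → not-9 c4 e14}) tt (inj₂ (inj₁ (m≤m+n 3 5)))
    start o01 o12 o23 o34 o24 o45 o47 o48 o58 o67 o68 o78 o8i c2 c4 c8 (yr h _) e14 e38 e56 e7i =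
      upper tt tt (λ ()) (λ {refl → o01}) tt (inj₁ (≤-trans (s≤s z≤n) h))
    start o01 o12 o23 o34 o24 o45 o47 o48 o58 o67 o68 o78 o8i c2 c4 c8 (x8i h) e14 e38 e56 e7i =
      ⊥-elim (c2 (≤-trans (m≤m+n 3 6) h))
    start o01 o12 o23 o34 o24 o45 o47 o48 o58 o67 o68 o78 o8i c2 c4 c8 (xr _ h) e14 e38 e56 e7i =
      ⊥-elim (c2 (≤-trans (m≤m+n 3 6) h))

-- Counting, degrees and cuts.

sum-allFin-suc : ∀ {n} (g : Fin (suc n) → ℕ) →
  sum (map g (allFin (suc n))) ≡ g zero + sum (map (g ∘ suc) (allFin n))
sum-allFin-suc {n} g = cong (λ l → g zero + sum l)
  (trans (map-tabulate {n = n} suc g) (sym (map-tabulate {n = n} id (g ∘ suc))))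

∧-true : ∀ {a b} → a ∧ b ≡ true → a ≡ true × b ≡ true
∧-true {true} h = refl , h

∨-true : ∀ {a b} → a ∨ b ≡ true → a ≡ true ⊎ b ≡ true
∨-true {true}  h = inj₁ refl
∨-true {false} h = inj₂ h

<ᵇ-true : ∀ {a b} → (a <ᵇ b) ≡ true → a < b
<ᵇ-true {a} {b} h = <ᵇ⇒< a b (Equivalence.from T-≡ h)

≡ᵇ-true : ∀ {a b} → (a ≡ᵇ b) ≡ true → a ≡ b
≡ᵇ-true {a} {b} h = ≡ᵇ⇒≡ a b (Equivalence.from T-≡ h)

edge-true : ∀ {n} (G : OGraph n) u v → edgeᵇ G u v ≡ true → Edge G u v
edge-true G u v h = <ᵇ-true (proj₁ (∧-true h)) , proj₂ (∧-true {toℕ u <ᵇ toℕ v} h)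

true-edge : ∀ {n} (G : OGraph n) {u v} → Edge G u v → edgeᵇ G u v ≡ true
true-edge G {u} {v} (p , q) = cong₂ _∧_ (Equivalence.to T-≡ (<⇒<ᵇ p)) q

count : ∀ {n} → (Fin n → Bool) → ℕ
count {n} f = sum (map (λ u → if f u then 1 else 0) (allFin n))

count-suc : ∀ {n} (f : Fin (suc n) → Bool) → count f ≡ (if f zero then 1 else 0) + count (f ∘ suc)
count-suc f = sum-allFin-suc (λ u → if f u then 1 else 0)

count-0 : ∀ {n} (f : Fin n → Bool) → (∀ x → ¬ f x ≡ true) → count f ≡ 0
count-0 {zero}  f h = refl
count-0 {suc n} f h rewrite count-suc f | ¬-not (h zero) = count-0 (f ∘ suc) (h ∘ suc)

count-1 : ∀ {n} (f : Fin n → Bool) u → f u ≡ true → (∀ x → f x ≡ true → x ≡ u) → count f ≡ 1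
count-1 f zero p h rewrite count-suc f | p = cong suc (count-0 (f ∘ suc) λ x q → Fin.0≢1+n (sym (h (suc x) q)))
count-1 f (suc u) p h rewrite count-suc f with f zero in eq
... | true  with () ← h zero eq
... | false = count-1 (f ∘ suc) u p λ x q → Fin.suc-injective (h (suc x) q)

count-2 : ∀ {n} (f : Fin n → Bool) u w → u <ᶠ w → f u ≡ true → f w ≡ true →
          (∀ x → f x ≡ true → x ≡ u ⊎ x ≡ w) → count f ≡ 2
count-2 f zero (suc w) lt p q h rewrite count-suc f | p = cong suc (count-1 (f ∘ suc) w q uniq)
  where
  uniq : ∀ x → f (suc x) ≡ true → x ≡ w
  uniq x r with inj₂ refl ← h (suc x) r = refl
count-2 f (suc u) (suc w) lt p q h rewrite count-suc f with f zero in eq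
... | true  = ⊥-elim ([ (λ ()) , (λ ()) ] (h zero eq))
... | false = count-2 (f ∘ suc) u w (≤-pred lt) p q λ x r →
  [ (λ {refl → inj₁ refl}) , (λ {refl → inj₂ refl}) ] (h (suc x) r)

module _ {n : ℕ} (G : OGraph n) where

  Touches : Fin n → Fin n → Set
  Touches v w = Edge G w v ⊎ Edge G v w

  neighbour : ∀ {v} → ¬ degree G v ≡ 0 → ∃ (Touches v)
  neighbour {v} h with Fin.any? (λ u → (edgeᵇ G u v ∨ edgeᵇ G v u) ≟ᵇ true)
  ... | yes (u , p) = u , Sum.map (edge-true G u v) (edge-true G v u) (∨-true p)
  ... | no  q       = ⊥-elim (h (count-0 _ λ x p → q (x , p)))

  degree-2 : ∀ {u v w} → Edge G u v → Edge G v w →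
             (∀ x → Edge G x v → x ≡ u) → (∀ x → Edge G v x → x ≡ w) → degree G v ≡ 2
  degree-2 {u} {v} {w} e e′ h h′ = count-2 _ u w (<-trans (proj₁ e) (proj₁ e′))
    (cong (_∨ edgeᵇ G v u) (true-edge G e)) (trans (cong (edgeᵇ G w v ∨_) (true-edge G e′)) (∨-zeroʳ _))
    λ x p → Sum.map (h x ∘ edge-true G x v) (h′ x ∘ edge-true G v x) (∨-true p)

  -- Without a crossing edge, splitting the edges by the side of their left end would separate G.
  -- Both parts are non-empty because each side has a vertex and no vertex is isolated.
  crossed : ¬ Separable G → (∀ v → ¬ degree G v ≡ 0) → (low : Fin n → Bool) →
            (∀ {u v} → u <ᶠ v → low v ≡ true → low u ≡ true) →
            (∃ λ u → low u ≡ true) → (∃ λ v → low v ≡ false) →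
            ¬ (∀ {u v} → Edge G u v → low u ≡ true → ¬ low v ≡ false)
  crossed nonsep deg low down (u₀ , p) (v₀ , q) none = nonsep
    ((λ u _ → low u) , below (proj₂ (neighbour (deg u₀))) , above (proj₂ (neighbour (deg v₀))) , ordered)
    where
    below : ∀ {w} → Touches u₀ w → ∃₂ λ u v → Edge G u v × low u ≡ true
    below (inj₁ e) = _ , _ , e , down (proj₁ e) p
    below (inj₂ e) = _ , _ , e , p

    above : ∀ {w} → Touches v₀ w → ∃₂ λ u v → Edge G u v × low u ≡ false
    above (inj₁ e) = _ , _ , e , ¬-not λ r → none e r q
    above (inj₂ e) = _ , _ , e , q

    ordered : ∀ u₁ v₁ u₂ v₂ → Edge G u₁ v₁ → low u₁ ≡ true → Edge G u₂ v₂ → low u₂ ≡ false →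
              (u₁ <ᶠ v₁) × (v₁ <ᶠ u₂) × (u₂ <ᶠ v₂)
    ordered u₁ v₁ u₂ v₂ e₁ r₁ e₂ r₂ = proj₁ e₁ , ≰⇒> v₁<u₂ , proj₁ e₂
      where
      v₁<u₂ : ¬ toℕ u₂ ≤ toℕ v₁
      v₁<u₂ h with low v₁ in eq | m≤n⇒m<n∨m≡n h
      ... | false | _ = none e₁ r₁ eq
      ... | true  | inj₁ lt with () ← trans (sym (down lt eq)) r₂
      ... | true  | inj₂ e with refl ← Fin.toℕ-injective e with () ← trans (sym eq) r₂

-- The unsaturated graph avoids G.

does-true : ∀ {p} {P : Set p} (d : Dec P) → does d ≡ true → P
does-true (yes p) h = p

does-false : ∀ {p} {P : Set p} (d : Dec P) → does d ≡ false → ¬ P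
does-false (no p) h = p

Monotone : ∀ {n} → (Fin n → Vertex) → Set
Monotone ψ = ∀ {u v} → u <ᶠ v → ψ u ≺ ψ v

-- Inside a block, a strictly increasing map gains at least one index per vertex.
climb↓ : ∀ {n} (ψ : Fin n → Vertex) → Monotone ψ → ∀ b s → (∀ u → ¬ ψ u ≺ (b , s)) →
         ∀ u → ¬ ψ u ≺ (b , s + toℕ u)
climb↓ ψ mono b s h zero    rewrite +-identityʳ s = h zero
climb↓ ψ mono b s h (suc u) rewrite +-suc s (toℕ u) =
  climb↓ (ψ ∘ suc) (mono ∘ s≤s) b (suc s) (λ v → h zero ∘ ≺-step↓ {ψ zero} {ψ (suc v)} {b} (mono (s≤s z≤n))) u

-- A vertex beyond the place of its own number pushes all later ones beyond theirs. With `s` zero, a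
-- block of `n + 1` places is then too short.
climb↑ : ∀ {n} (ψ : Fin (suc n) → Vertex) → Monotone ψ → ∀ b s u → (b , s + toℕ u) ≺ ψ u →
         ∃ λ v → (b , s + n) ≺ ψ v
climb↑ {zero}  ψ mono b s zero    h = zero , h
climb↑ {suc n} ψ mono b s zero    h
  with v , p ← climb↑ (ψ ∘ suc) (mono ∘ s≤s) b (suc s) zero (≺-step↑ {b} {s + 0} {ψ 0F} {ψ 1F} h (mono (s≤s z≤n)))
  = suc v , subst (λ x → (b , x) ≺ ψ (suc v)) (sym (+-suc s n)) p
climb↑ {suc n} ψ mono b s (suc u) h
  with v , p ← climb↑ (ψ ∘ suc) (mono ∘ s≤s) b (suc s) u (subst (λ x → (b , x) ≺ ψ (suc u)) (+-suc s (toℕ u)) h)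
  = suc v , subst (λ x → (b , x) ≺ ψ (suc v)) (sym (+-suc s n)) p

module _ {k lo : ℕ} where

  cross-11 : ∀ {a b} → (5 , 0) ≺ a → a ≢ (9 , 0) → a ≺ (11 , 0) → ¬ b ≺ (11 , 0) → ¬ Adj k lo a b
  cross-11 p q r s p5y       = s tt
  cross-11 p q r s q9y       = s tt
  cross-11 p q r s (yr _ _)  = s tt
  cross-11 p q r s (x8i _)   = q refl

  -- For a copy starting in block 4, three cuts matter. The first is crossed only by the edge into
  -- p, the second by the edges into q and out of p, the third by those out of p and out of q.
  cross-Z : ∀ {a b} → (3 , 0) ≺ a → a ≺ (4 , k + 4) → ¬ b ≺ (4 , k + 4) → Adj k lo a b →
            a ≡ (4 , lo) × b ≡ (6 , 0)
  cross-Z p q r (zl _ h) = ⊥-elim (r h)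
  cross-Z p q r lop      = refl , refl
  cross-Z p q r bq       = ⊥-elim (<-irrefl refl q)

  cross-7 : ∀ {a b} → (3 , 0) ≺ a → a ≢ (6 , 0) → a ≺ (7 , 0) → ¬ b ≺ (7 , 0) → Adj k lo a b →
            a ≡ (4 , k + 4) × b ≡ (8 , 0)
  cross-7 p q r s (zl _ h) = ⊥-elim (s tt)
  cross-7 p q r s lop      = ⊥-elim (s tt)
  cross-7 p q r s bq       = refl , refl
  cross-7 p q r s p5y      = ⊥-elim (q refl)

  cross-9 : ∀ {a b} → (3 , 0) ≺ a → a ≢ (6 , 0) → a ≢ (8 , 0) → a ≺ (9 , 0) → ¬ b ≺ (9 , 0) → ¬ Adj k lo a b
  cross-9 p q q′ r s (zl _ h) = s tt
  cross-9 p q q′ r s lop      = s tt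
  cross-9 p q q′ r s bq       = s tt
  cross-9 p q q′ r s p5y      = q refl
  cross-9 p q q′ r s q9y      = q′ refl

  into-p : ∀ {a} → Adj k lo a (6 , 0) → a ≡ (4 , lo)
  into-p lop = refl

  out-p : ∀ {b} → Adj k lo (6 , 0) b → b ≡ (10 , 4)
  out-p p5y = refl

  into-q : ∀ {a} → Adj k lo a (8 , 0) → a ≡ (4 , k + 4)
  into-q bq = refl

  out-q : ∀ {b} → Adj k lo (8 , 0) b → b ≡ (10 , 8)
  out-q q9y = refl

  -- The stretches before p, between p and q, and from q to block 9 offer no neighbour to a copy
  -- starting in block 4. As G has no isolated vertex, such a copy must skip them; `touch-p` and
  -- `touch-q` serve the same end.
  touch-Z : ∀ {a b} → lo < k + 4 → (4 , k + 4) ≺ a → (3 , 0) ≺ b → Adj k lo b a ⊎ Adj k lo a b → ¬ a ≺ (6 , 0)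
  touch-Z l p q (inj₁ (zl _ h)) r = <-asym h p
  touch-Z l p q (inj₂ (zl h _)) r = <-asym h p
  touch-Z l p q (inj₂ lop)      r = <-asym l p
  touch-Z l p q (inj₂ bq)       r = <-irrefl refl p

  touch-p : ∀ {a b} → (6 , 0) ≺ a → Adj k lo b a ⊎ Adj k lo a b → ¬ a ≺ (8 , 0)
  touch-p p  (inj₁ bq)  ()
  touch-p () (inj₁ lop) r
  touch-p () (inj₂ p5y) r

  touch-q : ∀ {a b} → (8 , 0) ≺ a → Adj k lo b a ⊎ Adj k lo a b → ¬ a ≺ (9 , 0)
  touch-q () (inj₁ bq)  r
  touch-q () (inj₂ q9y) r

record Heads {k : ℕ} (G : OGraph (9 + k)) : Set where
  field
    e02 : Edge G 0F 2F
    e14 : Edge G 1F 4F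
    e38 : Edge G 3F 8F
    e56 : Edge G 5F 6F
    {end₇} : Fin (9 + k)
    8<end₇ : 8 < toℕ end₇
    e7 : Edge G 7F end₇

module _ {k lo : ℕ} (lo< : lo < k + 4) {G : OGraph (9 + k)}
         (nonsep : ¬ Separable G) (deg≢0 : ∀ v → ¬ degree G v ≡ 0) (deg≢2 : ∀ v → ¬ degree G v ≡ 2)
         (heads : Heads G)
         (ψ : Fin (9 + k) → Vertex) (mono : Monotone ψ)
         (edge : ∀ {u v : Fin (9 + k)} → Edge G u v → Adj k lo (ψ u) (ψ v))
         (end-Y : ∀ v → ¬ ((10 , 8 + k) ≺ ψ v × ψ v ≺ (11 , 0)))
         (end-X : ∀ v → ¬ (11 , 8 + k) ≺ ψ v) where

  open Heads heads

  injective : ∀ {u v} → ψ u ≡ ψ v → u ≡ v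
  injective {u} {v} h with <-cmp (toℕ u) (toℕ v)
  ... | tri< p _ _ = ⊥-elim (≺-irrefl {ψ v} (subst (_≺ ψ v) h (mono p)))
  ... | tri≈ _ p _ = Fin.toℕ-injective p
  ... | tri> _ _ p = ⊥-elim (≺-irrefl {ψ v} (subst (ψ v ≺_) h (mono p)))

  cut : ∀ t → (∃ λ u → ψ u ≺ t) → (∃ λ v → ¬ ψ v ≺ t) →
        ¬ (∀ {u v} → Edge G u v → ψ u ≺ t → ¬ ¬ ψ v ≺ t)
  cut t (u₀ , p) (v₀ , q) h = crossed G nonsep deg≢0 (λ u → does (ψ u ≺? t))
    (λ {u} {v} lt r → dec-true (ψ u ≺? t) (≺-trans (ψ u) (ψ v) t (mono lt) (does-true (ψ v ≺? t) r)))
    (u₀ , dec-true (ψ u₀ ≺? t) p) (v₀ , dec-false (ψ v₀ ≺? t) q)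
    λ {u} {v} e r s → h e (does-true (ψ u ≺? t) r) (does-false (ψ v ≺? t) s)

  touches : ∀ v → ∃ λ w → Adj k lo (ψ w) (ψ v) ⊎ Adj k lo (ψ v) (ψ w)
  touches v with w , e ← neighbour G (deg≢0 v) = w , Sum.map edge edge e

  from-start : ∀ t → t ≺ ψ 0F → ∀ u → t ≺ ψ u
  from-start t h zero    = h
  from-start t h (suc u) = ≺-trans t (ψ 0F) (ψ (suc u)) h (mono (s≤s z≤n))

  bound-X : ∀ u → ¬ (11 , toℕ u) ≺ ψ u
  bound-X u h with v , p ← climb↑ ψ mono 11 0 u h = end-X v p

  not-upper : (5 , 0) ≺ ψ 0F → ψ 0F ≺ (11 , 0) → ψ 0F ≢ (9 , 0) → ψ 1F ≢ (9 , 0) → (9 , 0) ≺ ψ 2F →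
              ∀ u → ¬ (10 , toℕ u) ≺ ψ u
  not-upper p q r s t u h with v , x ← climb↑ ψ mono 10 0 u h = end-Y v (x , below-X v)
    where
    ≢9 : ∀ v → ψ v ≢ (9 , 0)
    ≢9 0F = r
    ≢9 1F = s
    ≢9 2F e = ≺-irrefl {9 , 0} (subst ((9 , 0) ≺_) e t)
    ≢9 (suc (suc (suc v))) e = ≺-irrefl {9 , 0} (subst ((9 , 0) ≺_) e
      (≺-trans (9 , 0) (ψ 2F) (ψ (suc (suc (suc v)))) t (mono (s≤s (s≤s (s≤s z≤n))))))

    below-X : ∀ v → ψ v ≺ (11 , 0)
    below-X v with ψ v ≺? (11 , 0)
    ... | yes x = x
    ... | no  x = ⊥-elim (cut (11 , 0) (0F , q) (v , x) λ {u} e y z → cross-11 (from-start (5 , 0) p u) (≢9 u) y z (edge e))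

  at : ∀ d → .(d < 5) → Fin (9 + k)
  at d h = fromℕ< {k + 4 + d} (subst (_< 9 + k) (sym (+-assoc k 4 d))
    (subst (k + (4 + d) <_) (+-comm k 9) (+-monoʳ-< k (+-monoʳ-< 4 h))))

  toℕ-at : ∀ d .h → toℕ (at d h) ≡ k + 4 + d
  toℕ-at d h = Fin.toℕ-fromℕ< _

  at-< : ∀ d .h .h′ → at d h <ᶠ at (suc d) h′
  at-< d h h′ rewrite toℕ-at d h | toℕ-at (suc d) h′ = +-monoʳ-< (k + 4) ≤-refl

  -- Crossing the first cut makes p a right end; `dead` then forbids p as a left end, so crossing
  -- the second cut makes q a right end. With both forbidden as left ends, nothing crosses the third
  -- cut.
  not-lower : ∀ {i} → i < k + 4 → ψ 0F ≢ (4 , i)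
  not-lower {i} i< eq = cut (4 , k + 4) (0F , subst (_≺ (4 , k + 4)) (sym eq) i<) (v₄ , v₄≮)
    λ {u} {v} e x y → let q , r = cross-Z (3≺ u) x y (edge e) in
    cut (7 , 0) (0F , subst (_≺ (7 , 0)) (sym eq) tt) (v₆ , v₆≮)
    λ {u′} {v′} e′ x′ y′ → let q′ , r′ = cross-7 (3≺ u′) (dead e into-p out-p q r e′) x′ y′ (edge e′) in
    cut (9 , 0) (0F , subst (_≺ (9 , 0)) (sym eq) tt) (v₇ , v₇≮)
    λ {u″} {v″} e″ x″ y″ → cross-9 (3≺ u″) (dead e into-p out-p q r e″) (dead e′ into-q out-q q′ r′ e″) x″ y″ (edge e″)
    where
    v₄ v₅ v₆ v₇ : Fin (9 + k)
    v₄ = at 0 (m≤m+n 1 4)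
    v₅ = at 1 (m≤m+n 2 3)
    v₆ = at 2 (m≤m+n 3 2)
    v₇ = at 3 (m≤m+n 4 1)

    3≺ : ∀ u → (3 , 0) ≺ ψ u
    3≺ = from-start (3 , 0) (subst ((3 , 0) ≺_) (sym eq) tt)

    4≮ : ∀ u → ¬ ψ u ≺ (4 , 0)
    4≮ zero    rewrite eq = λ ()
    4≮ (suc u) h = 4≮ zero (≺-trans (ψ 0F) (ψ (suc u)) (4 , 0) (mono (s≤s z≤n)) h)

    -- The copy starts in block 4, so vertex `k + 4` comes after the first `k + 4` places there. The
    -- next three vertices skip one stretch without neighbours each, which gives every cut a vertex
    -- on its right.
    v₄≮ : ¬ ψ v₄ ≺ (4 , k + 4)
    v₄≮ h = climb↓ ψ mono 4 0 4≮ v₄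
      (subst (λ x → ψ v₄ ≺ (4 , x)) (sym (trans (toℕ-at 0 (m≤m+n 1 4)) (+-identityʳ (k + 4)))) h)

    v₅≮ : ¬ ψ v₅ ≺ (6 , 0)
    v₅≮ with w , t ← touches v₅ = touch-Z lo< (≮≺-trans {4 , k + 4} {ψ v₄} {ψ v₅} v₄≮ (mono (at-< 0 (m≤m+n 1 4) (m≤m+n 2 3)))) (3≺ w) t

    6≺v₆ : (6 , 0) ≺ ψ v₆
    6≺v₆ = ≮≺-trans {6 , 0} {ψ v₅} {ψ v₆} v₅≮ (mono (at-< 1 (m≤m+n 2 3) (m≤m+n 3 2)))

    v₆≮8 : ¬ ψ v₆ ≺ (8 , 0)
    v₆≮8 = touch-p 6≺v₆ (proj₂ (touches v₆))

    v₆≮ : ¬ ψ v₆ ≺ (7 , 0)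
    v₆≮ h = v₆≮8 (≺-trans (ψ v₆) (7 , 0) (8 , 0) h tt)

    8≺v₇ : (8 , 0) ≺ ψ v₇
    8≺v₇ = ≮≺-trans {8 , 0} {ψ v₆} {ψ v₇} v₆≮8 (mono (at-< 2 (m≤m+n 3 2) (m≤m+n 4 1)))

    v₇≮ : ¬ ψ v₇ ≺ (9 , 0)
    v₇≮ = touch-q 8≺v₇ (proj₂ (touches v₇))

    -- A vertex of G placed at `b` and used as both a right and a left end would have exactly one
    -- neighbour on each side, hence degree two.
    dead : ∀ {a b c u v u′ w} → Edge G u v → (∀ {x} → Adj k lo x b → x ≡ a) → (∀ {x} → Adj k lo b x → x ≡ c) →
           ψ u ≡ a → ψ v ≡ b → Edge G u′ w → ψ u′ ≢ b
    dead {u = u} {v} {u′} {w} e into out p refl e′ q with refl ← injective q = deg≢2 v (degree-2 G e e′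
      (λ x f → injective (trans (into (edge f)) (sym p)))
      (λ x f → injective (trans (out (edge f)) (sym (out (edge e′))))))

  avoids : ⊥
  avoids with start k lo lo< (mono {0F} {1F} (m≤m+n 1 0)) (mono {1F} {2F} (m≤m+n 2 0)) (mono {2F} {3F} (m≤m+n 3 0))
    (mono {3F} {4F} (m≤m+n 4 0)) (mono {2F} {4F} (m≤m+n 3 1)) (mono {4F} {5F} (m≤m+n 5 0)) (mono {4F} {7F} (m≤m+n 5 2))
    (mono {4F} {8F} (m≤m+n 5 3)) (mono {5F} {8F} (m≤m+n 6 2)) (mono {6F} {7F} (m≤m+n 7 0)) (mono {6F} {8F} (m≤m+n 7 1))
    (mono {7F} {8F} (m≤m+n 8 0)) (mono {8F} 8<end₇) (bound-X 2F) (bound-X 4F) (bound-X 8F)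
    (edge e02) (edge e14) (edge e38) (edge e56) (edge e7)
  ... | lower i< p = not-lower i< p
  ... | upper p q r s t (inj₁ x)              = not-upper p q r s t 0F x
  ... | upper p q r s t (inj₂ (inj₁ x)) = not-upper p q r s t 2F x
  ... | upper p q r s t (inj₂ (inj₂ x)) = not-upper p q r s t 4F x

-- Greedy completion to a saturating graph.

anyVec? : ∀ {n} m {P : Vec (Fin n) m → Set} → (∀ v → Dec (P v)) → Dec (∃ P)
anyVec? zero    P? = map′ (λ p → [] , p) (λ {([] , p) → p}) (P? [])
anyVec? (suc m) P? = map′ (λ {(x , v , p) → (x ∷ v) , p}) (λ {((x ∷ v) , p) → x , v , p})
  (Fin.any? λ x → anyVec? m λ v → P? (x ∷ v))

module _ {n m : ℕ} (H : OGraph n) (G : OGraph m) where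

  Embedding : (Fin m → Fin n) → Set
  Embedding φ = (∀ u v → u <ᶠ v → φ u <ᶠ φ v) × (∀ u v → Edge G u v → Edge H (φ u) (φ v))

  Embedding? : ∀ φ → Dec (Embedding φ)
  Embedding? φ =
    (Fin.all? λ u → Fin.all? λ v → u Fin.<? v →-dec φ u Fin.<? φ v) ×-dec
    (Fin.all? λ u → Fin.all? λ v →
      (u Fin.<? v ×-dec G u v ≟ᵇ true) →-dec (φ u Fin.<? φ v ×-dec H (φ u) (φ v) ≟ᵇ true))

  -- The search runs over vectors, which can be enumerated; tabulating a given map replaces function
  -- extensionality.
  Contains? : Dec (Contains H G)
  Contains? = map′ (λ {(v , p) → Vec.lookup v , p}) tab (anyVec? m (Embedding? ∘ Vec.lookup))
    where
    tab : Contains H G → ∃ (Embedding ∘ Vec.lookup)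
    tab (φ , p , q) = Vec.tabulate φ ,
      (λ u v h → subst₂ _<ᶠ_ (sym (lookup∘tabulate φ u)) (sym (lookup∘tabulate φ v)) (p u v h)) ,
      (λ u v e → subst₂ (Edge H) (sym (lookup∘tabulate φ u)) (sym (lookup∘tabulate φ v)) (q u v e))

_⊑_ : ∀ {n} → OGraph n → OGraph n → Set
H ⊑ K = ∀ u v → H u v ≡ true → K u v ≡ true

contains-mono : ∀ {n m} {H K : OGraph n} {G : OGraph m} → H ⊑ K → Contains H G → Contains K G
contains-mono s (φ , p , q) = φ , p , λ u v e → proj₁ (q u v e) , s (φ u) (φ v) (proj₂ (q u v e))

true-∨ˡ : ∀ {a b} → a ≡ true → a ∨ b ≡ true
true-∨ˡ refl = refl

true-∨ʳ : ∀ a {b} → b ≡ true → a ∨ b ≡ true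
true-∨ʳ a refl = ∨-zeroʳ a

addEdge-mono : ∀ {n} {H K : OGraph n} {u v} → H ⊑ K → addEdge H u v ⊑ addEdge K u v
addEdge-mono {H = H} {K} s x y h = [ true-∨ˡ ∘ s x y , true-∨ʳ (K x y) ] (∨-true {H x y} h)

≡ᵇ-refl : ∀ a → (a ≡ᵇ a) ≡ true
≡ᵇ-refl a = Equivalence.to T-≡ (≡⇒≡ᵇ a a refl)

added : ∀ {n} (H : OGraph n) u v → addEdge H u v u v ≡ true
added H u v = true-∨ʳ (H u v) (cong₂ _∧_ (≡ᵇ-refl (toℕ u)) (≡ᵇ-refl (toℕ v)))

addEdge-⊑ : ∀ {n} {H K : OGraph n} {u v} → H ⊑ K → K u v ≡ true → addEdge H u v ⊑ K
addEdge-⊑ {H = H} {K} {u} {v} s e x y h with ∨-true {H x y} h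
... | inj₁ p = s x y p
... | inj₂ p with q , r ← ∧-true {toℕ x ≡ᵇ toℕ u} p
  with refl ← Fin.toℕ-injective {i = x} {u} (≡ᵇ-true q) | refl ← Fin.toℕ-injective {i = y} {v} (≡ᵇ-true r) = e

module _ {n m : ℕ} (G : OGraph m) where

  -- A rejected pair stays rejected, because containment survives the addition of further edges; one
  -- pass over all pairs therefore suffices.
  complete : (ps : List (Fin n × Fin n)) (H : OGraph n) → ¬ Contains H G → ∃ λ K → H ⊑ K × ¬ Contains K G ×
             All (λ (u , v) → K u v ≡ true ⊎ Contains (addEdge K u v) G) ps
  complete []             H avoid = H , (λ _ _ h → h) , avoid , []
  complete ((u , v) ∷ ps) H avoid with Contains? (addEdge H u v) G
  ... | yes c with K , s , avoid′ , all ← complete ps H avoid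
        = K , s , avoid′ , inj₂ (contains-mono (addEdge-mono s) c) ∷ all
  ... | no  c with K , s , avoid′ , all ← complete ps (addEdge H u v) c
        = K , (λ x y → s x y ∘ true-∨ˡ) , avoid′ , inj₁ (s u v (added H u v)) ∷ all

  saturate : (H : OGraph n) → ¬ Contains H G → ∃ λ K → H ⊑ K × Saturates K G
  saturate H avoid with K , s , avoid′ , all ← complete (cartesianProduct (allFin n) (allFin n)) H avoid
    = K , s , avoid′ , λ u v _ ≡false →
        [ (λ ≡true → case trans (sym ≡false) ≡true of λ ()) , id ]
        (All.lookup all (∈-cartesianProduct⁺ (∈-allFin u) (∈-allFin v)))

-- Counting edges that miss an interval.

sum-outside : ∀ {n} (f : Fin n → ℕ) b a l c → n ≤ a + (l + c) → (∀ x → f x ≤ b) →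
              (∀ x → a ≤ toℕ x → toℕ x < a + l → f x ≡ 0) → sum (map f (allFin n)) ≤ (a + c) * b
sum-outside {zero}  f b a l c n≤ f≤ f≡0 = z≤n
sum-outside {suc n} f b (suc a) l c n≤ f≤ f≡0 rewrite sum-allFin-suc f =
  +-mono-≤ (f≤ zero) (sum-outside (f ∘ suc) b a l c (≤-pred n≤) (f≤ ∘ suc) λ x p q → f≡0 (suc x) (s≤s p) (s≤s q))
sum-outside {suc n} f b zero (suc l) c n≤ f≤ f≡0 rewrite sum-allFin-suc f | f≡0 zero z≤n (s≤s z≤n) =
  sum-outside (f ∘ suc) b zero l c (≤-pred n≤) (f≤ ∘ suc) λ x _ q → f≡0 (suc x) z≤n (s≤s q)
sum-outside {suc n} f b zero zero (suc c) n≤ f≤ f≡0 rewrite sum-allFin-suc f =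
  +-mono-≤ (f≤ zero) (sum-outside (f ∘ suc) b zero zero c (≤-pred n≤) (f≤ ∘ suc) λ x _ ())

-- `sum-outside` is applied to the rows and again within each row; the factor 1 bounds a single
-- entry.
edgeCount-outside : ∀ {n} (H : OGraph n) a l c → n ≤ a + (l + c) →
  (∀ {u v} → Edge H u v → ¬ (a ≤ toℕ u × toℕ u < a + l) × ¬ (a ≤ toℕ v × toℕ v < a + l)) →
  edgeCount H ≤ (a + c) * ((a + c) * 1)
edgeCount-outside {n} H a l c n≤ out = sum-outside _ _ a l c n≤
  (λ u → sum-outside _ 1 a l c n≤ (λ v → indicator≤1 (edgeᵇ H u v))
    λ v p q → indicator≡0 λ e → proj₂ (out (edge-true H u v e)) (p , q))
  (λ u p q → count-0 (edgeᵇ H u) λ v e → proj₁ (out (edge-true H u v e)) (p , q))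
  where
  indicator≤1 : ∀ b → (if b then 1 else 0) ≤ 1
  indicator≤1 true  = ≤-refl
  indicator≤1 false = z≤n
  indicator≡0 : ∀ {b} → ¬ b ≡ true → (if b then 1 else 0) ≡ 0
  indicator≡0 {true}  h = ⊥-elim (h refl)
  indicator≡0 {false} h = refl

-- Copies of G created by a new edge touching I.

≺-≮-trans : ∀ {s t b} → s ≺ t → ¬ b ≺ t → s ≺ b
≺-≮-trans {s , i} {t , j} {b , l} = go s t b
  where
  go : ∀ s t b → lex s t (i < j) → ¬ lex b t (l < j) → lex s b (i < l)
  go zero    zero    zero    p n = <-≤-trans p (≮⇒≥ n)
  go zero    zero    (suc b) p n = tt
  go zero    (suc t) zero    p n = ⊥-elim (n tt)
  go zero    (suc t) (suc b) p n = tt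
  go (suc s) (suc t) zero    p n = ⊥-elim (n tt)
  go (suc s) (suc t) (suc b) p n = go s t b p n

data Head : ℕ → ℕ → Set where
  h02   : Head 0 2
  h14   : Head 1 4
  h38   : Head 3 8
  h56   : Head 5 6
  h7    : ∀ {y} → Head 7 (9 + y)
  later : ∀ {x y} → Head (9 + x) (9 + y)

-- Here `lo` will be vertex 1 (0-based) of the second matching, that is `k` for `Q` and `k + 2` for
-- `R`.
data Tail (k lo : ℕ) : ℕ → ℕ → Set where
  inner : ∀ {x y} → y < k + 4 → Tail k lo x y
  tlo   : Tail k lo lo (k + 5)
  tb    : Tail k lo (k + 4) (k + 7)
  tlast : Tail k lo (k + 6) (k + 8)

-- Blocks 4, 10 and 11 have one place per vertex of G, and the intended copies put vertex `w` at
-- place `w` of these blocks. This is where the indices 4, 8 and `k + 4` in `Adj` come from.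
sizes : ℕ → ℕ → List ℕ
sizes k l = 1 ∷ 1 ∷ 1 ∷ 1 ∷ 9 + k ∷ 1 ∷ 1 ∷ l ∷ 1 ∷ 1 ∷ 9 + k ∷ 9 + k ∷ []

steps : ∀ m (ρ : ℕ → Vertex) → (∀ w → suc w < m → ρ w ≺ ρ (suc w)) → ∀ {x y} → x < y → y < m → ρ x ≺ ρ y
steps m ρ h {x} {suc y} (s≤s p) q with m≤n⇒m<n∨m≡n p
... | inj₁ r    = ≺-trans (ρ x) (ρ y) (ρ (suc y)) (steps m ρ h r (<⇒≤ q)) (h y q)
... | inj₂ refl = h y q

module _ (k lo l : ℕ) where

  pos : Fin (sum (sizes k l)) → Vertex
  pos x = decode (sizes k l) (toℕ x)

  pos-mono : Monotone pos
  pos-mono = decode-mono (sizes k l)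

  pos-reflect : ∀ {x y} → pos x ≺ pos y → x <ᶠ y
  pos-reflect {x} {y} h with <-cmp (toℕ x) (toℕ y)
  ... | tri< p _ _ = p
  ... | tri≈ _ p _ = ⊥-elim (≺-irrefl {pos y} (subst (λ z → decode (sizes k l) z ≺ pos y) p h))
  ... | tri> _ _ p = ⊥-elim (≺-irrefl {pos x} (≺-trans (pos x) (pos y) (pos x) h (pos-mono p)))

  pos-injective : ∀ {x y} → pos x ≡ pos y → x ≡ y
  pos-injective {x} {y} h with <-cmp (toℕ x) (toℕ y)
  ... | tri< p _ _ = ⊥-elim (≺-irrefl {pos y} (subst (_≺ pos y) h (pos-mono p)))
  ... | tri≈ _ p _ = Fin.toℕ-injective p
  ... | tri> _ _ p = ⊥-elim (≺-irrefl {pos y} (subst (pos y ≺_) h (pos-mono p)))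

  pos-valid : ∀ x → Valid (sizes k l) (pos x)
  pos-valid x = decode-valid (sizes k l) (Fin.toℕ<n x)

  point : ∀ v → Valid (sizes k l) v → ∃ λ x → pos x ≡ v
  point v h = fromℕ< (encode-< (sizes k l) v h) ,
    trans (cong (decode (sizes k l)) (Fin.toℕ-fromℕ< _)) (decode∘encode (sizes k l) v h)

  base : OGraph (sum (sizes k l))
  base x y = does (Adj? k lo (pos x) (pos y))

  base-true : ∀ {x y a b} → pos x ≡ a → pos y ≡ b → Adj k lo a b → base x y ≡ true
  base-true {x} {y} refl refl h = dec-true (Adj? k lo (pos x) (pos y)) h

  added-true : ∀ {u v x y a b} → pos x ≡ a → pos y ≡ b → Adj k lo a b ⊎ a ≡ pos u × b ≡ pos v →
               addEdge base u v x y ≡ true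
  added-true p q (inj₁ h) = true-∨ˡ (base-true p q h)
  added-true {u} {v} p q (inj₂ (r , s)) with refl ← pos-injective (trans p r) | refl ← pos-injective (trans q s) =
    added base u v

  module _ {G : OGraph (9 + k)} (u v : Fin (sum (sizes k l))) where

    place : (ρ : ℕ → Vertex) → (∀ w → w < 9 + k → Valid (sizes k l) (ρ w)) →
            (∀ w → suc w < 9 + k → ρ w ≺ ρ (suc w)) →
            (∀ {x y} → Edge G x y → Adj k lo (ρ (toℕ x)) (ρ (toℕ y)) ⊎ ρ (toℕ x) ≡ pos u × ρ (toℕ y) ≡ pos v) →
            Contains (addEdge base u v) G
    place ρ valid step edge = φ , φ-mono , φ-edge
      where
      φ : Fin (9 + k) → Fin (sum (sizes k l))
      φ x = proj₁ (point (ρ (toℕ x)) (valid (toℕ x) (Fin.toℕ<n x)))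

      pos-φ : ∀ x → pos (φ x) ≡ ρ (toℕ x)
      pos-φ x = proj₂ (point (ρ (toℕ x)) (valid (toℕ x) (Fin.toℕ<n x)))

      φ-mono : ∀ x y → x <ᶠ y → φ x <ᶠ φ y
      φ-mono x y h = pos-reflect (subst₂ _≺_ (sym (pos-φ x)) (sym (pos-φ y)) (steps (9 + k) ρ step h (Fin.toℕ<n y)))

      φ-edge : ∀ x y → Edge G x y → Edge (addEdge base u v) (φ x) (φ y)
      φ-edge x y e = φ-mono x y (proj₁ e) , added-true (pos-φ x) (pos-φ y) (edge e)

    module _ (head : ∀ {x y : Fin (9 + k)} → Edge G x y → Head (toℕ x) (toℕ y))
             (tail : ∀ {x y : Fin (9 + k)} → Edge G x y → Tail k lo (toℕ x) (toℕ y)) where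

      as-02 : pos u ≺ (6 , 0) → (6 , 0) ≺ pos v → pos v ≺ (8 , 0) → Contains (addEdge base u v) G
      as-02 p q r = place ρ valid step (edge ∘ head)
        where
        ρ : ℕ → Vertex
        ρ 0 = pos u
        ρ 1 = 6 , 0
        ρ 2 = pos v
        ρ 3 = 8 , 0
        ρ w@(suc (suc (suc (suc _)))) = 10 , w

        valid : ∀ w → w < 9 + k → Valid (sizes k l) (ρ w)
        valid 0 h = pos-valid u
        valid 1 h = ≤-refl
        valid 2 h = pos-valid v
        valid 3 h = ≤-refl
        valid (suc (suc (suc (suc _)))) h = h

        step : ∀ w → suc w < 9 + k → ρ w ≺ ρ (suc w)
        step 0 _ = p
        step 1 _ = q
        step 2 _ = r
        step 3 _ = tt
        step (suc (suc (suc (suc _)))) _ = ≤-refl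

        edge : ∀ {x y} → Head x y → Adj k lo (ρ x) (ρ y) ⊎ ρ x ≡ pos u × ρ y ≡ pos v
        edge h02   = inj₂ (refl , refl)
        edge h14   = inj₁ p5y
        edge h38   = inj₁ q9y
        edge h56   = inj₁ (yr (m≤m+n 5 0) (m≤m+n 5 1))
        edge h7    = inj₁ (yr (m≤m+n 5 2) (m≤m+n 5 _))
        edge later = inj₁ (yr (m≤m+n 5 _) (m≤m+n 5 _))

      as-56 : (5 , 0) ≺ pos u → pos u ≺ pos v → pos v ≺ (9 , 0) → Contains (addEdge base u v) G
      as-56 p q r = place ρ valid step (edge ∘ head)
        where
        ρ : ℕ → Vertex
        ρ 0 = 0 , 0
        ρ 1 = 1 , 0
        ρ 2 = 2 , 0
        ρ 3 = 3 , 0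
        ρ 4 = 5 , 0
        ρ 5 = pos u
        ρ 6 = pos v
        ρ 7 = 9 , 0
        ρ w@(suc (suc (suc (suc (suc (suc (suc (suc _)))))))) = 11 , w

        valid : ∀ w → w < 9 + k → Valid (sizes k l) (ρ w)
        valid 0 h = ≤-refl
        valid 1 h = ≤-refl
        valid 2 h = ≤-refl
        valid 3 h = ≤-refl
        valid 4 h = ≤-refl
        valid 5 h = pos-valid u
        valid 6 h = pos-valid v
        valid 7 h = ≤-refl
        valid (suc (suc (suc (suc (suc (suc (suc (suc _)))))))) h = h

        step : ∀ w → suc w < 9 + k → ρ w ≺ ρ (suc w)
        step 0 _ = tt
        step 1 _ = tt
        step 2 _ = tt
        step 3 _ = tt
        step 4 _ = p
        step 5 _ = q
        step 6 _ = r
        step 7 _ = tt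
        step (suc (suc (suc (suc (suc (suc (suc (suc _)))))))) _ = ≤-refl

        edge : ∀ {x y} → Head x y → Adj k lo (ρ x) (ρ y) ⊎ ρ x ≡ pos u × ρ y ≡ pos v
        edge h02   = inj₁ x13
        edge h14   = inj₁ x25
        edge h38   = inj₁ x49
        edge h56   = inj₂ (refl , refl)
        edge h7    = inj₁ (x8i (m≤m+n 9 _))
        edge later = inj₁ (xr (m≤m+n 9 _) (m≤m+n 9 _))

      as-last : lo < k + 4 → (6 , 0) ≺ pos u → pos u ≺ (8 , 0) → (8 , 0) ≺ pos v → Contains (addEdge base u v) G
      as-last lo< p q r = place (ρ 0 (k + 5)) (λ w → valid 0 (k + 5) w)
        -- The last step leads from vertex `k + 7` to `k + 8`; beyond it `τ` is constant.
        (λ w h → step 0 (k + 5) w (subst (w <_) (trans (+-comm 8 k) (sym (+-assoc k 5 3))) (≤-pred h)))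
        (λ e → edge (proj₁ e) (tail e))
        where
        τ : ℕ → Vertex
        τ 0 = 6 , 0
        τ 1 = pos u
        τ 2 = 8 , 0
        τ (suc (suc (suc _))) = pos v

        -- Vertices up to `k + 4` fill block 4 and the remaining four follow `τ`: `s` is the next
        -- index in the block, `c` the number of block vertices still to come.
        ρ : ℕ → ℕ → ℕ → Vertex
        ρ s zero    w       = τ w
        ρ s (suc c) zero    = 4 , s
        ρ s (suc c) (suc w) = ρ (suc s) c w

        ρ-Z : ∀ s c {w} → w < c → ρ s c w ≡ (4 , s + w)
        ρ-Z s (suc c) {zero}  h       = cong (4 ,_) (sym (+-identityʳ s))
        ρ-Z s (suc c) {suc w} (s≤s h) = trans (ρ-Z (suc s) c h) (cong (4 ,_) (sym (+-suc s w)))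

        ρ-τ : ∀ s c d → ρ s c (c + d) ≡ τ d
        ρ-τ s zero    d = refl
        ρ-τ s (suc c) d = ρ-τ (suc s) c d

        ρ-τ′ : ∀ d → ρ 0 (k + 5) (k + (5 + d)) ≡ τ d
        ρ-τ′ d = trans (cong (ρ 0 (k + 5)) (sym (+-assoc k 5 d))) (ρ-τ 0 (k + 5) d)

        valid : ∀ s c w → s + w < 9 + k → Valid (sizes k l) (ρ s c w)
        valid s zero    0 h = ≤-refl
        valid s zero    1 h = pos-valid u
        valid s zero    2 h = ≤-refl
        valid s zero    (suc (suc (suc _))) h = pos-valid v
        valid s (suc c) zero    h = ≤-trans (s≤s (m≤m+n s 0)) h
        valid s (suc c) (suc w) h = valid (suc s) c w (subst (_< 9 + k) (+-suc s w) h)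

        step : ∀ s c w → w < c + 3 → ρ s c w ≺ ρ s c (suc w)
        step s zero 0 h = p
        step s zero 1 h = q
        step s zero 2 h = r
        step s zero (suc (suc (suc _))) (s≤s (s≤s (s≤s ())))
        step s (suc zero)    zero    h       = tt
        step s (suc (suc c)) zero    h       = ≤-refl
        step s (suc c)       (suc w) (s≤s h) = step (suc s) c w h

        4<5 : k + 4 < k + 5
        4<5 = +-monoʳ-< k ≤-refl

        edge : ∀ {x y} → x < y → Tail k lo x y → Adj k lo (ρ 0 (k + 5) x) (ρ 0 (k + 5) y) ⊎
               ρ 0 (k + 5) x ≡ pos u × ρ 0 (k + 5) y ≡ pos v
        edge x<y (inner y<) = inj₁ (subst₂ (Adj k lo) (sym (ρ-Z 0 (k + 5) (<-trans (<-trans x<y y<) 4<5)))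
          (sym (ρ-Z 0 (k + 5) (<-trans y< 4<5))) (zl (<-trans x<y y<) y<))
        edge _ tlo   = inj₁ (subst₂ (Adj k lo) (sym (ρ-Z 0 (k + 5) (<-trans lo< 4<5))) (sym (ρ-τ′ 0)) lop)
        edge _ tb    = inj₁ (subst₂ (Adj k lo) (sym (ρ-Z 0 (k + 5) 4<5)) (sym (ρ-τ′ 2)) bq)
        edge _ tlast = inj₂ (ρ-τ′ 1 , ρ-τ′ 3)

      -- The splits are at block 9 and at p, so that new edges from p into I or from I to q also
      -- take the role of 56.
      covered : lo < k + 4 → u <ᶠ v → (∃ λ i → pos u ≡ (7 , i)) ⊎ (∃ λ i → pos v ≡ (7 , i)) →
                Contains (addEdge base u v) G
      covered lo< u<v (inj₁ (i , eq)) with pos v ≺? (9 , 0)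
      ... | yes p = as-56 (subst ((5 , 0) ≺_) (sym eq) tt) (pos-mono u<v) p
      ... | no  p = as-last lo< (subst ((6 , 0) ≺_) (sym eq) tt) (subst (_≺ (8 , 0)) (sym eq) tt)
                      (≺-≮-trans {8 , 0} {9 , 0} {pos v} tt p)
      covered lo< u<v (inj₂ (i , eq)) with pos u ≺? (6 , 0)
      ... | yes p = as-02 p (subst ((6 , 0) ≺_) (sym eq) tt) (subst (_≺ (8 , 0)) (sym eq) tt)
      ... | no  p = as-56 (≺-≮-trans {5 , 0} {6 , 0} {pos u} tt p) (pos-mono u<v) (subst (_≺ (9 , 0)) (sym eq) tt)

-- Boundedness from the shape of the first and last edges.

valid-end-X : ∀ k l a → Valid (sizes k l) a → ¬ (11 , 8 + k) ≺ a
valid-end-X k l (11 , i) h p = <⇒≱ h p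

valid-end-Y : ∀ k l a → Valid (sizes k l) a → (10 , 8 + k) ≺ a → ¬ a ≺ (11 , 0)
valid-end-Y k l (10 , i) h p _ = <⇒≱ h p
valid-end-Y k l (11 , i) h p ()

bounded : ∀ {k lo} {G : OGraph (9 + k)} → lo < k + 4 → Heads G →
  (∀ {x y} → Edge G x y → Head (toℕ x) (toℕ y)) → (∀ {x y} → Edge G x y → Tail k lo (toℕ x) (toℕ y)) → Claim G
bounded {k} {lo} {G} lo< heads head tail nonsep deg≢0 deg≢2 =
  (a + c) * ((a + c) * 1) , a + c , λ n N≤n →
    subst (λ n → Σ (OGraph n) λ H → Saturates H G × (edgeCount H ≤ (a + c) * ((a + c) * 1)))
      (trans (total (n ∸ (a + c))) (m+[n∸m]≡n N≤n)) (graph (n ∸ (a + c)))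
  where
  a c : ℕ
  -- The numbers of vertices before and after I; only the length of I grows with `n`.
  a = 4 + (9 + k + 2)
  c = 2 + (9 + k + (9 + k + 0))

  size : ∀ l → sum (sizes k l) ≡ a + (l + c)
  size l = cong (4 +_) (sym (+-assoc (9 + k) 2 (l + c)))

  total : ∀ l → sum (sizes k l) ≡ a + c + l
  total l = trans (size l) (trans (cong (a +_) (+-comm l c)) (sym (+-assoc a c l)))

  base-avoids : ∀ l → ¬ Contains (base k lo l) G
  base-avoids l (φ , mono , edge) = avoids lo< nonsep deg≢0 deg≢2 heads (pos k lo l ∘ φ)
    (λ {u} {v} p → pos-mono k lo l {φ u} {φ v} (mono u v p))
    (λ {u} {v} e → does-true (Adj? k lo (pos k lo l (φ u)) (pos k lo l (φ v))) (proj₂ (edge u v e)))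
    (λ v (p , q) → valid-end-Y k l (pos k lo l (φ v)) (pos-valid k lo l (φ v)) p q)
    (λ v → valid-end-X k l (pos k lo l (φ v)) (pos-valid k lo l (φ v)))

  pos-I : ∀ l x → a ≤ toℕ x × toℕ x < a + l → ∃ λ i → pos k lo l x ≡ (7 , i)
  pos-I l x (p , q) = toℕ x ∸ a , trans
    (cong (decode (sizes k l)) (trans (sym eq) (cong (4 +_) (+-assoc (9 + k) 2 (toℕ x ∸ a)))))
    (decode∘encode (sizes k l) (7 , toℕ x ∸ a) (+-cancelˡ-< a (toℕ x ∸ a) l (subst (_< a + l) (sym eq) q)))
    where
    eq : a + (toℕ x ∸ a) ≡ toℕ x
    eq = m+[n∸m]≡n p

  module _ {l : ℕ} {H : OGraph (sum (sizes k l))} (base⊑H : base k lo l ⊑ H) (avoid : ¬ Contains H G) where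

    -- Otherwise the base graph together with this edge would contain G and lie inside `H`.
    not-I : ∀ {u v} → Edge H u v →
            ¬ ((∃ λ i → pos k lo l u ≡ (7 , i)) ⊎ (∃ λ i → pos k lo l v ≡ (7 , i)))
    not-I {u} {v} (u<v , e) i = avoid
      (contains-mono {H = addEdge (base k lo l) u v} (addEdge-⊑ base⊑H e) (covered k lo l u v head tail lo< u<v i))

    outside : ∀ {u v} → Edge H u v → ¬ (a ≤ toℕ u × toℕ u < a + l) × ¬ (a ≤ toℕ v × toℕ v < a + l)
    outside {u} {v} e = (λ p → not-I e (inj₁ (pos-I l u p))) , (λ p → not-I e (inj₂ (pos-I l v p)))

  graph : ∀ l → Σ (OGraph (sum (sizes k l))) λ H → Saturates H G × (edgeCount H ≤ (a + c) * ((a + c) * 1))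
  graph l = finish (saturate G (base k lo l) (base-avoids l))
    where
    finish : (∃ λ H → base k lo l ⊑ H × Saturates H G) → _
    finish (H , base⊑H , sat) =
      H , sat , edgeCount-outside H a l c (≤-reflexive (size l)) (outside base⊑H (proj₁ sat))

-- The edges of the glued graph.

any-true : ∀ {A : Set} (f : A → Bool) xs → any f xs ≡ true → ∃ λ x → x ∈ xs × f x ≡ true
any-true f (x ∷ xs) h with ∨-true {f x} h
... | inj₁ p = x , here refl , p
... | inj₂ q with y , y∈ , r ← any-true f xs q = y , there y∈ , r

true-any : ∀ {A : Set} (f : A → Bool) {xs x} → x ∈ xs → f x ≡ true → any f xs ≡ true
true-any f (here refl) h = true-∨ˡ h
true-any f {y ∷ _} (there p) h = true-∨ʳ (f y) (true-any f p h)

fromEdges-∈ : ∀ {n} es (x y : Fin n) → fromEdges n es x y ≡ true → (suc (toℕ x) , suc (toℕ y)) ∈ es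
fromEdges-∈ es x y h with (a , b) , p , q ← any-true _ es h with r , s ← ∧-true {suc (toℕ x) ≡ᵇ a} q =
  subst (_∈ es) (sym (cong₂ _,_ (≡ᵇ-true {suc (toℕ x)} r) (≡ᵇ-true {suc (toℕ y)} s))) p

any₂ : ∀ {k} → (Fin k → Fin k → Bool) → Bool
any₂ {k} f = any (λ x → any (f x) (allFin k)) (allFin k)

any₂-true : ∀ {k} (f : Fin k → Fin k → Bool) → any₂ f ≡ true → ∃₂ λ x y → f x y ≡ true
any₂-true f h with x , _ , p ← any-true _ (allFin _) h with y , _ , q ← any-true (f x) (allFin _) p = x , y , q

true-any₂ : ∀ {k} (f : Fin k → Fin k → Bool) x y → f x y ≡ true → any₂ f ≡ true
true-any₂ {k} f x y h = true-any (λ x → any (f x) (allFin k)) (∈-allFin x) (true-any (f x) (∈-allFin y) h)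

-- The labelling of the vertices of G₂ inside glue is a private pattern-matching function, so it has to be
-- evaluated at zero and at suc; unfolding the disjunction over all vertices once separates the two.
any-suc : ∀ {n} (f : Fin (suc n) → Bool) {c} → c ∨ foldr _∨_ false (map f (tabulate suc)) ≡ true →
          c ≡ true ⊎ ∃ λ x → f (suc x) ≡ true
any-suc f h with ∨-true h
... | inj₁ p = inj₁ p
... | inj₂ q with x , x∈ , r ← any-true f (tabulate suc) q with y , refl ← ∈-tabulate⁻ x∈ = inj₂ (y , r)

module _ {k : ℕ} (K : OGraph k) where

  Image : (Fin k → ℕ) → ℕ → ℕ → Set
  Image e u v = ∃₂ λ x y → Edge K x y × e x ≡ u × e y ≡ v

  entry : Fin k → Fin k → ℕ → ℕ → ℕ → ℕ → Bool
  entry x y a b u v = edgeᵇ K x y ∧ (a ≡ᵇ u) ∧ (b ≡ᵇ v)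

  entry-true : ∀ {x y a b u v} → entry x y a b u v ≡ true → Edge K x y × a ≡ u × b ≡ v
  entry-true {x} {y} {a} h with p , q ← ∧-true {edgeᵇ K x y} h with r , s ← ∧-true {a ≡ᵇ _} q =
    edge-true K x y p , ≡ᵇ-true r , ≡ᵇ-true s

  true-entry : ∀ {x y} a b → Edge K x y → entry x y a b a b ≡ true
  true-entry a b e = cong₂ _∧_ (true-edge K e) (cong₂ _∧_ (≡ᵇ-refl a) (≡ᵇ-refl b))

module _ {a n₀ b : ℕ} (G₁ : OGraph (suc a)) (A : OGraph n₀) (G₂ : OGraph (suc b)) (i j : Fin n₀) where

  -- Restates a private labelling of `glue`; it unfolds to the same expression, so no case split is
  -- needed on this side.
  left : Fin (suc a) → ℕ
  left x = if toℕ x <ᵇ a then toℕ x else a + toℕ i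

  right : Fin (suc b) → ℕ
  right zero    = a + toℕ j
  right (suc y) = a + n₀ + toℕ y

  left-entry : ℕ → ℕ → Fin (suc a) → Fin (suc a) → Bool
  left-entry u v x y = entry G₁ x y (left x) (left y) u v

  glue-edge : ∀ {u v} → Edge (glue G₁ A G₂ i j) u v →
    Image G₁ left (toℕ u) (toℕ v) ⊎ Image A (λ x → a + toℕ x) (toℕ u) (toℕ v) ⊎ Image G₂ right (toℕ u) (toℕ v)
  glue-edge {u} {v} (_ , h) with ∨-true {any₂ (left-entry (toℕ u) (toℕ v))} h
  ... | inj₁ p with x , y , q ← any₂-true (left-entry (toℕ u) (toℕ v)) p =
    inj₁ (x , y , entry-true G₁ {x} {y} {left x} {left y} q)
  ... | inj₂ p with ∨-true p
  ... | inj₁ q with x , y , r ← any₂-true _ q = inj₂ (inj₁ (x , y , entry-true A {x} {y} {a + toℕ x} {a + toℕ y} r))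
  ... | inj₂ q with any-suc _ q
  ... | inj₁ r with any-suc _ r
  ... | inj₁ s       = inj₂ (inj₂ (0F , 0F , entry-true G₂ {0F} {0F} {right 0F} {right 0F} s))
  ... | inj₂ (y , s) = inj₂ (inj₂ (0F , suc y , entry-true G₂ {0F} {suc y} {right 0F} {right (suc y)} s))
  glue-edge {u} {v} (_ , h) | inj₂ p | inj₂ q | inj₂ (x , r) with any-suc _ r
  ... | inj₁ s       = inj₂ (inj₂ (suc x , 0F , entry-true G₂ {suc x} {0F} {right (suc x)} {right 0F} s))
  ... | inj₂ (y , s) = inj₂ (inj₂ (suc x , suc y , entry-true G₂ {suc x} {suc y} {right (suc x)} {right (suc y)} s))

  glue-left : ∀ {u v} x y → Edge G₁ x y → left x ≡ toℕ u → left y ≡ toℕ v → u <ᶠ v → Edge (glue G₁ A G₂ i j) u v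
  glue-left {u} {v} x y e p q u<v = u<v , true-∨ˡ {any₂ (left-entry (toℕ u) (toℕ v))}
    (true-any₂ (left-entry (toℕ u) (toℕ v)) x y
      (subst₂ (λ c d → left-entry c d x y ≡ true) p q (true-entry G₁ (left x) (left y) e)))

endpoints : ∀ {n} {x y : Fin n} x′ y′ → (suc (toℕ x) , suc (toℕ y)) ≡ (suc (toℕ x′) , suc (toℕ y′)) →
            x ≡ x′ × y ≡ y′
endpoints _ _ e = Fin.toℕ-injective (suc-injective (cong proj₁ e)) , Fin.toℕ-injective (suc-injective (cong proj₂ e))

module _ {n₀ b : ℕ} (A : OGraph n₀) (G₂ : OGraph (suc b)) (i j : Fin n₀) where

  glue-heads : Heads {n₀ + b} (glue P A G₂ i j)
  glue-heads = record
    { e02  = glue-left P A G₂ i j 0F 2F (m≤m+n 1 1 , refl) refl refl (m≤m+n 1 1)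
    ; e14  = glue-left P A G₂ i j 1F 4F (m≤m+n 2 2 , refl) refl refl (m≤m+n 2 2)
    ; e38  = glue-left P A G₂ i j 3F 8F (m≤m+n 4 4 , refl) refl refl (m≤m+n 4 4)
    ; e56  = glue-left P A G₂ i j 5F 6F (m≤m+n 6 0 , refl) refl refl (m≤m+n 6 0)
    -- The last vertex of `P` is identified with vertex `i` of `A`, which has number `9 + i`.
    ; end₇ = 9 ↑ʳ (i ↑ˡ b)
    ; 8<end₇ = m≤m+n 9 _
    ; e7   = glue-left P A G₂ i j 7F 9F (m≤m+n 8 1 , refl) refl (cong (9 +_) (sym (Fin.toℕ-↑ˡ i b))) (m≤m+n 8 _)
    }

  left-P : ∀ {u v} → Image P (left P A G₂ i j) u v → Head u v × v < 9 + n₀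
  left-P (x , y , (_ , e) , refl , refl)
      with fromEdges-∈ ((1 , 3) ∷ (2 , 5) ∷ (4 , 9) ∷ (6 , 7) ∷ (8 , 10) ∷ []) x y e
  ... | here p                         with refl , refl ← endpoints 0F 2F p = h02 , m≤m+n 3 _
  ... | there (here p)                 with refl , refl ← endpoints 1F 4F p = h14 , m≤m+n 5 _
  ... | there (there (here p))         with refl , refl ← endpoints 3F 8F p = h38 , m≤m+n 9 _
  ... | there (there (there (here p))) with refl , refl ← endpoints 5F 6F p = h56 , m≤m+n 7 _
  ... | there (there (there (there (here p)))) with refl , refl ← endpoints 7F 9F p =
    h7 , +-monoʳ-< 9 (Fin.toℕ<n i)

  -- Here `k` is `n₀ + b`, and `lo` is `9 + n₀ + 0`, literally the value of `right` at vertex 1 of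
  -- `G₂`.
  glue-bounded : 9 ≤ b + 4 → 9 + n₀ + 0 < n₀ + b + 4 →
    (∀ {u v} → Image G₂ (right P A G₂ i j) u v → Head u v × Tail (n₀ + b) (9 + n₀ + 0) u v) →
    Claim (glue P A G₂ i j)
  glue-bounded 9≤ lo< tail = bounded {n₀ + b} lo< glue-heads
    (λ e → proj₁ (shape (glue-edge P A G₂ i j e))) (λ e → proj₂ (shape (glue-edge P A G₂ i j e)))
    where
    -- The edges of `P` and `A` all end before `9 + n₀`, which is at most `k + 4`.
    short : ∀ {u v} → v < 9 + n₀ → Tail (n₀ + b) (9 + n₀ + 0) u v
    short h = inner (<-≤-trans h (subst₂ _≤_ (+-comm n₀ 9) (sym (+-assoc n₀ b 4)) (+-monoʳ-≤ n₀ 9≤)))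

    shape : ∀ {u v} →
      Image P (left P A G₂ i j) u v ⊎ Image A (λ x → 9 + toℕ x) u v ⊎ Image G₂ (right P A G₂ i j) u v →
      Head u v × Tail (n₀ + b) (9 + n₀ + 0) u v
    shape (inj₁ p) with h , v< ← left-P p = h , short v<
    shape (inj₂ (inj₁ (x , y , _ , refl , refl))) = later , short (+-monoʳ-< 9 (Fin.toℕ<n y))
    shape (inj₂ (inj₂ p)) = tail p

-- The last edges for `Q` and for `R`.

module _ (n₀ : ℕ) where

  -- Turns the offset `d` given by `right` into the offset `e` from `k = n₀ + b` that `Tail`
  -- expects.
  reindex : ∀ {b d e} → 9 + d ≡ b + e → 9 + n₀ + d ≡ n₀ + b + e
  reindex {b} {d} {e} h = trans (cong (_+ d) (+-comm 9 n₀)) (trans (+-assoc n₀ 9 d)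
    (trans (cong (n₀ +_) h) (sym (+-assoc n₀ b e))))

  reindex-< : ∀ {b d e} → 9 + d ≡ b + e → e < 4 → 9 + n₀ + d < n₀ + b + 4
  reindex-< {b} {d} {e} h e<4 = subst (_< n₀ + b + 4) (sym (reindex {b} {d} {e} h)) (+-monoʳ-< (n₀ + b) e<4)

  module _ (A : OGraph n₀) (i j : Fin n₀) where

    tail-Q : ∀ {u v} → Image Q (right P A Q i j) u v → Head u v × Tail (n₀ + 9) (9 + n₀ + 0) u v
    tail-Q (x , y , (_ , e) , refl , refl)
      with fromEdges-∈ ((1 , 3) ∷ (2 , 7) ∷ (4 , 5) ∷ (6 , 9) ∷ (8 , 10) ∷ []) x y e
    ... | here p with refl , refl ← endpoints 0F 2F p =
      later , inner (reindex-< {9} {1} {1} refl (m≤m+n 2 2))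
    ... | there (here p) with refl , refl ← endpoints 1F 6F p =
      later , subst (Tail (n₀ + 9) (9 + n₀ + 0) (9 + n₀ + 0)) (sym (reindex {9} {5} {5} refl)) tlo
    ... | there (there (here p)) with refl , refl ← endpoints 3F 4F p =
      later , inner (reindex-< {9} {3} {3} refl (m≤m+n 4 0))
    ... | there (there (there (here p))) with refl , refl ← endpoints 5F 8F p =
      later , subst₂ (Tail (n₀ + 9) (9 + n₀ + 0)) (sym (reindex {9} {4} {4} refl)) (sym (reindex {9} {7} {7} refl)) tb
    ... | there (there (there (there (here p)))) with refl , refl ← endpoints 7F 9F p =
      later , subst₂ (Tail (n₀ + 9) (9 + n₀ + 0)) (sym (reindex {9} {6} {6} refl)) (sym (reindex {9} {8} {8} refl)) tlast

    tail-R : ∀ {u v} → Image R (right P A R i j) u v → Head u v × Tail (n₀ + 7) (9 + n₀ + 0) u v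
    tail-R (x , y , (_ , e) , refl , refl)
      with fromEdges-∈ ((1 , 3) ∷ (2 , 5) ∷ (4 , 7) ∷ (6 , 8) ∷ []) x y e
    ... | here p with refl , refl ← endpoints 0F 2F p =
      later , inner (reindex-< {7} {1} {3} refl (m≤m+n 4 0))
    ... | there (here p) with refl , refl ← endpoints 1F 4F p =
      later , subst (Tail (n₀ + 7) (9 + n₀ + 0) (9 + n₀ + 0)) (sym (reindex {7} {3} {5} refl)) tlo
    ... | there (there (here p)) with refl , refl ← endpoints 3F 6F p =
      later , subst₂ (Tail (n₀ + 7) (9 + n₀ + 0)) (sym (reindex {7} {2} {4} refl)) (sym (reindex {7} {5} {7} refl)) tb
    ... | there (there (there (here p))) with refl , refl ← endpoints 5F 7F p =
      later , subst₂ (Tail (n₀ + 7) (9 + n₀ + 0)) (sym (reindex {7} {4} {6} refl)) (sym (reindex {7} {6} {8} refl)) tlast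

theorem5 : (n₀ : ℕ) (A : OGraph n₀) (i j : Fin n₀) →
    Claim (glue P A Q i j) × Claim (glue P A R i j)
theorem5 n₀ A i j =
  glue-bounded A Q i j (m≤m+n 9 4) (reindex-< n₀ {9} {0} {0} refl (m≤m+n 1 3)) (tail-Q n₀ A i j) ,
  glue-bounded A R i j (m≤m+n 9 2) (reindex-< n₀ {7} {0} {2} refl (m≤m+n 3 1)) (tail-R n₀ A i j)
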